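{- The readability of the graph $G(n)$ is $\Omega\left(\sqrt{\frac{\log n}{\log\log n}}\right)$ as $n\to\infty$; that is, there exist a constant $c>0$ and an integer $N$ such that for all $n\ge N$ the readability of $G(n)$ is at least $c\sqrt{\frac{\log n}{\log\log n}}$.
   Context: For a positive integer $n$, $G(n)$ is the bipartite graph with vertices $x_1,\ldots,x_n$ and $y_1,\ldots,y_n$ whose edges are the pairs $x_iy_j$ with $i\le j$. A (monotone Boolean) formula is a formula built from variables using only the Boolean operations OR (written $+$) and AND (written $*$), with no negations. For a positive integer $k$, a formula is read-$k$ if no variable occurs more than $k$ times in it. For a triangle-free graph $G$ without isolated vertices, let $\phi(G)$ be the formula $\sum_{uv\in E(G)} u*v$, whose variables are the vertices of $G$ and whose terms are the edges of $G$. The readability of $G$ is the smallest $k$ such that there is a read-$k$ monotone Boolean formula logically equivalent to $\phi(G)$; equivalently, a read-$k$ monotone formula whose minterms are precisely the edges of $G$. -}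

module Defs where

open import Data.Bool.Base using (Bool; false; _∧_; _∨_; if_then_else_)
open import Data.Fin.Base using (Fin) renaming (_≤_ to _≤ᶠ_)
import Data.Fin.Properties as Fin
open import Data.Integer.Base using (ℤ; +_; -[1+_])
open import Data.List.Base using (List; []; _∷_; _++_; map; filter; allFin)
open import Data.List.Membership.Propositional using (_∈_)
open import Data.List.Membership.Propositional.Properties
  using (∈-map⁺; ∈-map⁻; ∈-++⁺ˡ; ∈-++⁺ʳ; ∈-allFin)
open import Data.List.Relation.Unary.Unique.Propositional using (Unique)
import Data.List.Relation.Unary.Unique.Propositional.Properties as Unique
open import Data.Maybe.Base using (Maybe; just; nothing; maybe′)
open import Data.Nat.Base as ℕ using (ℕ; suc)
import Data.Nat.Properties as ℕ
open import Data.Product.Base using (Σ; ∃; _×_; _,_)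
open import Data.Rational.Unnormalised.Base
  using (ℚᵘ; 0ℚᵘ; _/_; _<_; _≤_; _*_; ↥_; ↧ₙ_; +-*-rawSemiring)
open import Data.Sum.Base using (_⊎_; inj₁; inj₂)
open import Data.Sum.Properties using (≡-dec; inj₁-injective; inj₂-injective)
open import Relation.Binary.Definitions using (DecidableEquality; Decidable; Symmetric; Irreflexive)
open import Relation.Binary.PropositionalEquality using (_≡_; refl)
open import Relation.Nullary using (¬_; yes; no; does)
open import Algebra.Definitions.RawSemiring +-*-rawSemiring using () renaming (_^_ to _^ℚ_)

infixl 6 _⊕_
infixl 7 _⊗_

-- Monotone formulas have no constants; ⊕ is OR and ⊗ is AND.
data Formula (V : Set) : Set where
  var     : V → Formula V
  _⊕_ _⊗_ : Formula V → Formula V → Formula V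

eval : ∀ {V} → (V → Bool) → Formula V → Bool
eval ρ (var v) = ρ v
eval ρ (f ⊕ g) = eval ρ f ∨ eval ρ g
eval ρ (f ⊗ g) = eval ρ f ∧ eval ρ g

occurrences : ∀ {V} → DecidableEquality V → V → Formula V → ℕ
occurrences _≟_ v (var u) = if does (u ≟ v) then 1 else 0
occurrences _≟_ v (f ⊕ g) = occurrences _≟_ v f ℕ.+ occurrences _≟_ v g
occurrences _≟_ v (f ⊗ g) = occurrences _≟_ v f ℕ.+ occurrences _≟_ v g

ReadAtMost : ∀ {V} → DecidableEquality V → ℕ → Formula V → Set
ReadAtMost _≟_ k f = ∀ v → occurrences _≟_ v f ℕ.≤ k

-- The empty sum is not a formula; it is represented by `nothing` and
-- denotes the constant false.
∑ : ∀ {V} → List (Formula V) → Maybe (Formula V)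
∑ []       = nothing
∑ (f ∷ fs) = just (maybe′ (f ⊕_) f (∑ fs))

evalSum : ∀ {V} → (V → Bool) → Maybe (Formula V) → Bool
evalSum ρ = maybe′ (eval ρ) false

-- Finite simple graphs that are triangle-free and have no isolated vertices.
record Graph : Set₁ where
  infix 4 _≟_
  field
    V            : Set
    _≟_          : DecidableEquality V
    vertices     : List V
    unique       : Unique vertices
    complete     : ∀ v → v ∈ vertices
    Adj          : V → V → Set
    adj?         : Decidable Adj
    symmetric    : Symmetric Adj
    irreflexive  : Irreflexive _≡_ Adj
    triangleFree : ∀ {u v w} → Adj u v → Adj v w → ¬ Adj u w
    noIsolated   : ∀ u → ∃ (Adj u)

  -- Each edge appears once, oriented along the order of the vertex list.
  edgesAmong : List V → List (V × V)
  edgesAmong []       = []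
  edgesAmong (u ∷ us) = map (u ,_) (filter (adj? u) us) ++ edgesAmong us

  edges : List (V × V)
  edges = edgesAmong vertices

open Graph using (V)

φ : (𝒢 : Graph) → Maybe (Formula (V 𝒢))
φ 𝒢 = ∑ (map (λ (u , v) → var u ⊗ var v) (Graph.edges 𝒢))

HasReadFormula : Graph → ℕ → Set
HasReadFormula 𝒢 k =
  Σ (Formula (V 𝒢)) λ f →
    ReadAtMost (Graph._≟_ 𝒢) k f × (∀ ρ → eval ρ f ≡ evalSum ρ (φ 𝒢))

IsReadability : Graph → ℕ → Set
IsReadability 𝒢 k = HasReadFormula 𝒢 k × (∀ j → HasReadFormula 𝒢 j → k ℕ.≤ j)

module HalfGraph (n : ℕ) where

  Vertex : Set
  Vertex = Fin n ⊎ Fin n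

  pattern x i = inj₁ i
  pattern y j = inj₂ j

  data Edge : Vertex → Vertex → Set where
    xy : ∀ {i j} → i ≤ᶠ j → Edge (x i) (y j)
    yx : ∀ {i j} → i ≤ᶠ j → Edge (y j) (x i)

  edge? : Decidable Edge
  edge? (x i) (x j) = no λ ()
  edge? (y i) (y j) = no λ ()
  edge? (x i) (y j) with i Fin.≤? j
  ... | yes p = yes (xy p)
  ... | no ¬p = no λ { (xy p) → ¬p p }
  edge? (y j) (x i) with i Fin.≤? j
  ... | yes p = yes (yx p)
  ... | no ¬p = no λ { (yx p) → ¬p p }

  vertexList : List Vertex
  vertexList = map inj₁ (allFin n) ++ map inj₂ (allFin n)

  vertexList-unique : Unique vertexList
  vertexList-unique =
    Unique.++⁺ (Unique.map⁺ inj₁-injective (Unique.allFin⁺ n))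
               (Unique.map⁺ inj₂-injective (Unique.allFin⁺ n))
               disjoint
    where
    disjoint : ∀ {v} → ¬ (v ∈ map inj₁ (allFin n) × v ∈ map inj₂ (allFin n))
    disjoint (p , q) with ∈-map⁻ inj₁ p | ∈-map⁻ inj₂ q
    ... | _ , _ , refl | _ , _ , ()

  vertexList-complete : ∀ v → v ∈ vertexList
  vertexList-complete (x i) = ∈-++⁺ˡ (∈-map⁺ inj₁ (∈-allFin i))
  vertexList-complete (y j) = ∈-++⁺ʳ (map inj₁ (allFin n)) (∈-map⁺ inj₂ (∈-allFin j))

G : ℕ → Graph
G n = record
  { V            = Vertex
  ; _≟_          = ≡-dec Fin._≟_ Fin._≟_
  ; vertices     = vertexList
  ; unique       = vertexList-unique
  ; complete     = vertexList-complete
  ; Adj          = Edge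
  ; adj?         = edge?
  ; symmetric    = λ { (xy p) → yx p ; (yx p) → xy p }
  ; irreflexive  = λ { refl () }
  ; triangleFree = λ { (xy _) (yx _) () ; (yx _) (xy _) () }
  ; noIsolated   = λ { (x i) → y i , xy ℕ.≤-refl ; (y j) → x j , yx ℕ.≤-refl }
  }
  where open HalfGraph n

-- A real number is given by its Dedekind cuts: `lower a q` means q < a and
-- `upper a q` means a < q.
record Real : Set₁ where
  field
    lower upper : ℚᵘ → Set

open Real public

infix 4 _≤ᴿ_
_≤ᴿ_ : Real → Real → Set
a ≤ᴿ b = ∀ q → lower a q → lower b q

fromℕ : ℕ → Real
fromℕ n .lower q = q < + n / 1
fromℕ n .upper q = + n / 1 < q

2^_ : ℤ → ℚᵘ
2^ (+ m)    = + (2 ℕ.^ m) / 1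
2^ -[1+ m ] = + 1 / (2 ℕ.^ suc m)
  where instance _ = ℕ.m^n≢0 2 (suc m)

-- For a > 0.  With r = p/q, the comparison of 2^r with a rational s > 0 is
-- that of 2^p with s^q; and r < log₂ a holds iff 2^r ≤ s < a for some such s.
log₂ : Real → Real
log₂ a .lower r = ∃ λ s → 0ℚᵘ < s × lower a s × 2^ (↥ r) ≤ s ^ℚ (↧ₙ r)
log₂ a .upper r = ∃ λ s → 0ℚᵘ < s × upper a s × s ^ℚ (↧ₙ r) ≤ 2^ (↥ r)

-- For a ≥ 0 and b > 0.
infixl 7 _÷ᴿ_
_÷ᴿ_ : Real → Real → Real
(a ÷ᴿ b) .lower r = ∃ λ t → upper b t × lower a (r * t)
(a ÷ᴿ b) .upper r = ∃ λ t → 0ℚᵘ < t × lower b t × upper a (r * t)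

-- For a ≥ 0.
√ : Real → Real
√ a .lower r = r < 0ℚᵘ ⊎ lower a (r * r)
√ a .upper r = 0ℚᵘ < r × upper a (r * r)

-- For c > 0.
infixl 7 _·_
_·_ : ℚᵘ → Real → Real
(c · a) .lower r = ∃ λ s → lower a s × r ≤ c * s
(c · a) .upper r = ∃ λ s → upper a s × c * s ≤ r

{-# OPTIONS --safe #-}
-- Suppose f(x) = 0, f(y_j) = 0 and f(x, y_j) = 1 for all j ∈ J.  Descending from
-- the root through gates that are true at {x, y_j} but at neither x nor y_j leads
-- to an AND gate g ⊗ h with g(x) = 1 and h(y_j) = 1 (up to order), where g is a
-- maximal subformula true at x.  There are at most as many such g as occurrences
-- of x, so a single gate serves a k-th part of J; for those j the factor h is true
-- whenever y_j is, so g ⊗ h may be replaced by g, and every such y_j loses an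
-- occurrence.  Taking for x the second smallest x_i and iterating until the y_j are
-- used up gives n ≤ (k + 1)^k ≤ 2^(k²) if G(n) has readability k.
-- Hence log n ≤ k², and log log n ≥ 1 once n ≥ 4.
module Submission where

open import Defs
open import Data.Bool.Base using (Bool; true; false; _∧_; _∨_)
open import Data.Bool.Properties using (∨-zeroʳ; ∧-comm; ∧-identityʳ; ¬-not)
open import Data.Fin.Base as Fin using (Fin)
import Data.Fin.Properties as Fin
open import Data.Integer.Base as ℤ using (+_; -[1+_]; +≤+)
import Data.Integer.Properties as ℤ
open import Data.List.Base using (List; []; _∷_; _++_; length; map; allFin)
open import Data.List.Membership.Propositional using (_∈_)
open import Data.List.Membership.Propositional.Properties
  using (∈-map⁺; ∈-map⁻; ∈-++⁺ˡ; ∈-++⁺ʳ; ∈-++⁻; ∈-filter⁺; ∈-filter⁻; ∈-allFin)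
open import Data.List.Properties using (length-tabulate)
open import Data.List.Relation.Binary.Sublist.Propositional
  using (_⊆_; []; _∷_; _∷ʳ_; ⊆-refl; ⊆-trans; lookup)
open import Data.List.Relation.Binary.Sublist.Propositional.Properties using (All-resp-⊆)
open import Data.List.Relation.Unary.All as All using (All; []; _∷_)
open import Data.List.Relation.Unary.AllPairs using (AllPairs; []; _∷_)
import Data.List.Relation.Unary.AllPairs.Properties as AllPairs
open import Data.List.Relation.Unary.Any using (here; there)
open import Data.Nat.Base as ℕ using (ℕ; zero; suc; _≥_; z≤n; s≤s)
import Data.Nat.Properties as ℕ
open import Data.Product.Base using (∃-syntax; ∃₂; _×_; _,_; proj₁; proj₂)
open import Data.Rational.Unnormalised.Base
  using (ℚᵘ; 0ℚᵘ; 1ℚᵘ; _/_; _<_; _≤_; _*_; ↥_; ↧ₙ_; mkℚᵘ; *≤*; *<*;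
         NonNegative; nonNegative; +-*-rawSemiring)
import Data.Rational.Unnormalised.Properties as ℚ
open import Data.Sum.Base using (_⊎_; inj₁; inj₂; [_,_]′)
open import Function.Base using (_∘_; id; case_of_)
open import Relation.Binary.Definitions using (DecidableEquality)
open import Relation.Binary.PropositionalEquality
  using (_≡_; refl; sym; trans; cong; cong₂; subst; subst₂)
open import Relation.Nullary using (¬_; does; yes; no; contradiction)
open import Relation.Nullary.Decidable using (dec-true)
open import Algebra.Definitions.RawSemiring +-*-rawSemiring using () renaming (_^_ to _^ℚ_)

-- Truth values and sublists.

∧-true : ∀ {a b} → a ∧ b ≡ true → a ≡ true × b ≡ true
∧-true {true} {true} refl = refl , refl

∨-false : ∀ {a b} → a ∨ b ≡ false → a ≡ false × b ≡ false
∨-false {false} {false} refl = refl , refl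

∨-true : ∀ {a b} → a ∨ b ≡ true → a ≡ true ⊎ b ≡ true
∨-true {true}  eq = inj₁ refl
∨-true {false} eq = inj₂ eq

true≢false : ∀ {a} → a ≡ true → ¬ a ≡ false
true≢false refl ()

module _ {A : Set} where

  AllPairs-resp-⊆ : ∀ {R : A → A → Set} {xs ys} → xs ⊆ ys → AllPairs R ys → AllPairs R xs
  AllPairs-resp-⊆ []         []       = []
  AllPairs-resp-⊆ (_ ∷ʳ p)   (_ ∷ rs) = AllPairs-resp-⊆ p rs
  AllPairs-resp-⊆ (refl ∷ p) (r ∷ rs) = All-resp-⊆ p r ∷ AllPairs-resp-⊆ p rs

  empty-length : ∀ {xs : List A} → (∀ {x} → ¬ x ∈ xs) → length xs ≡ 0
  empty-length {[]}    _  = refl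
  empty-length {_ ∷ _} ∉ = contradiction (here refl) ∉

  All-split : ∀ {P Q : A → Set} {xs} → All (λ x → P x ⊎ Q x) xs →
              ∃₂ λ ys zs → (ys ⊆ xs × All P ys) × (zs ⊆ xs × All Q zs) ×
                           length xs ≡ length ys ℕ.+ length zs
  All-split [] = [] , [] , ([] , []) , ([] , []) , refl
  All-split (p ∷ ps) with All-split ps | p
  ... | ys , zs , (s , as) , (t , bs) , eq | inj₁ a =
    _ ∷ ys , zs , (refl ∷ s , a ∷ as) , (_ ∷ʳ t , bs) , cong suc eq
  ... | ys , zs , (s , as) , (t , bs) , eq | inj₂ b =
    ys , _ ∷ zs , (_ ∷ʳ s , as) , (refl ∷ t , b ∷ bs) ,
    trans (cong suc eq) (sym (ℕ.+-suc (length ys) (length zs)))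

-- Monotone formulas and the removal of redundant factors.

module Reductions {V : Set} (_≟_ : DecidableEquality V) where

  occ : V → Formula V → ℕ
  occ = occurrences _≟_

  ⟨_⟩ : V → V → Bool
  ⟨ v ⟩ w = does (w ≟ v)

  ⟪_,_⟫ : V → V → V → Bool
  ⟪ u , v ⟫ w = ⟨ u ⟩ w ∨ ⟨ v ⟩ w

  infix 4 _≤ᵇ_
  _≤ᵇ_ : (ρ σ : V → Bool) → Set
  ρ ≤ᵇ σ = ∀ v → ρ v ≡ true → σ v ≡ true

  ⟨⟩-self : ∀ v → ⟨ v ⟩ v ≡ true
  ⟨⟩-self v = dec-true (v ≟ v) refl

  ⟨⟩-true⁻ : ∀ u v → ⟨ v ⟩ u ≡ true → u ≡ v
  ⟨⟩-true⁻ u v eq with u ≟ v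
  ... | yes p = p

  ⟨⟩≤ᵇ : ∀ {ρ} v → ρ v ≡ true → ⟨ v ⟩ ≤ᵇ ρ
  ⟨⟩≤ᵇ v ρv u eq rewrite ⟨⟩-true⁻ u v eq = ρv

  ⟨⟩≤ᵇ⟪⟫ : ∀ u v → ⟨ u ⟩ ≤ᵇ ⟪ u , v ⟫
  ⟨⟩≤ᵇ⟪⟫ u v w eq rewrite eq = refl

  ⟪⟫-right : ∀ u v → ⟪ u , v ⟫ v ≡ true
  ⟪⟫-right u v rewrite ⟨⟩-self v = ∨-zeroʳ _

  eval-mono : ∀ {ρ σ} → ρ ≤ᵇ σ → ∀ f → eval ρ f ≡ true → eval σ f ≡ true
  eval-mono le (var v) eq = le v eq
  eval-mono {ρ} le (f ⊕ g) eq with ∨-true {eval ρ f} eq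
  ... | inj₁ p rewrite eval-mono le f p = refl
  ... | inj₂ p rewrite eval-mono le g p = ∨-zeroʳ _
  eval-mono {ρ} le (f ⊗ g) eq with ∧-true {eval ρ f} eq
  ... | p , q rewrite eval-mono le f p | eval-mono le g q = refl

  -- Without constants a true value must come from a true leaf, and `⟨ v ⟩` makes only leaves
  -- labelled `v` true.
  eval-true⇒occ : ∀ v f → eval ⟨ v ⟩ f ≡ true → 1 ℕ.≤ occ v f
  eval-true⇒occ v (var u) eq rewrite eq = s≤s z≤n
  eval-true⇒occ v (f ⊕ g) eq with ∨-true {eval ⟨ v ⟩ f} eq
  ... | inj₁ p = ℕ.≤-trans (eval-true⇒occ v f p) (ℕ.m≤m+n _ _)
  ... | inj₂ p = ℕ.≤-trans (eval-true⇒occ v g p) (ℕ.m≤n+m _ _)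
  eval-true⇒occ v (f ⊗ g) eq =
    ℕ.≤-trans (eval-true⇒occ v f (proj₁ (∧-true eq))) (ℕ.m≤m+n _ _)

  module _ {I : Set} (y : I → V) where

    -- An m-th part of J for which the gate g ⊗ h can be replaced by g.
    record Reduction (f : Formula V) (m : ℕ) (J : List I) : Set where
      field
        kept    : List I
        reduced : Formula V
        kept⊆   : kept ⊆ J
        length≤ : length J ℕ.≤ m ℕ.* length kept
        agree   : ∀ {j} ρ → j ∈ kept → ρ (y j) ≡ true → eval ρ reduced ≡ eval ρ f
        occ-≤   : ∀ v → occ v reduced ℕ.≤ occ v f
        occ-<   : ∀ {j} → j ∈ kept → occ (y j) reduced ℕ.< occ (y j) f

    open Reduction

    -- Covers all four one-gate contexts: truth values pass through `op`, and the sibling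
    -- contributes the fixed count `e`, so a strict loss of occurrences inside `g` stays strict in
    -- `C g`.
    Reduction-context : ∀ (C : Formula V → Formula V) (op : (V → Bool) → Bool → Bool) (e : V → ℕ) →
                        (∀ ρ g → eval ρ (C g) ≡ op ρ (eval ρ g)) →
                        (∀ v g → occ v (C g) ≡ occ v g ℕ.+ e v) →
                        ∀ {g m J} → Reduction g m J → Reduction (C g) m J
    Reduction-context C op e eval-C occ-C {g} r = record
      { kept    = kept r
      ; reduced = C (reduced r)
      ; kept⊆   = kept⊆ r
      ; length≤ = length≤ r
      ; agree   = λ ρ j∈ ρy →
          trans (eval-C ρ _) (trans (cong (op ρ) (agree r ρ j∈ ρy)) (sym (eval-C ρ g)))
      ; occ-≤   = λ v → subst₂ ℕ._≤_ (sym (occ-C v _)) (sym (occ-C v g))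
                          (ℕ.+-monoˡ-≤ (e v) (occ-≤ r v))
      ; occ-<   = λ {j} j∈ → subst₂ ℕ._<_ (sym (occ-C (y j) _)) (sym (occ-C (y j) g))
                               (ℕ.+-monoˡ-< (e (y j)) (occ-< r j∈))
      }

    Reduction-⊕ˡ : ∀ {g h m J} → Reduction g m J → Reduction (g ⊕ h) m J
    Reduction-⊕ˡ {h = h} = Reduction-context (_⊕ h) (λ ρ b → b ∨ eval ρ h) (λ v → occ v h)
      (λ _ _ → refl) (λ _ _ → refl)

    Reduction-⊕ʳ : ∀ {g h m J} → Reduction h m J → Reduction (g ⊕ h) m J
    Reduction-⊕ʳ {g} = Reduction-context (g ⊕_) (λ ρ b → eval ρ g ∨ b) (λ v → occ v g)
      (λ _ _ → refl) (λ v _ → ℕ.+-comm (occ v g) _)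

    Reduction-⊗ˡ : ∀ {g h m J} → Reduction g m J → Reduction (g ⊗ h) m J
    Reduction-⊗ˡ {h = h} = Reduction-context (_⊗ h) (λ ρ b → b ∧ eval ρ h) (λ v → occ v h)
      (λ _ _ → refl) (λ _ _ → refl)

    Reduction-⊗ʳ : ∀ {g h m J} → Reduction h m J → Reduction (g ⊗ h) m J
    Reduction-⊗ʳ {g} = Reduction-context (g ⊗_) (λ ρ b → eval ρ g ∧ b) (λ v → occ v g)
      (λ _ _ → refl) (λ v _ → ℕ.+-comm (occ v g) _)

    Reduction-swap : ∀ {g h m J} → Reduction (g ⊗ h) m J → Reduction (h ⊗ g) m J
    Reduction-swap {g} {h} r = record
      { kept    = kept r
      ; reduced = reduced r
      ; kept⊆   = kept⊆ r
      ; length≤ = length≤ r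
      ; agree   = λ ρ j∈ ρy → trans (agree r ρ j∈ ρy) (∧-comm (eval ρ g) _)
      ; occ-≤   = λ v → ℕ.≤-trans (occ-≤ r v) (ℕ.≤-reflexive (ℕ.+-comm (occ v g) _))
      ; occ-<   = λ {j} j∈ → ℕ.<-≤-trans (occ-< r j∈) (ℕ.≤-reflexive (ℕ.+-comm (occ (y j) g) _))
      }

    -- By monotonicity `h` is true wherever `y j` is, so it is a redundant factor there; and it
    -- contains `y j`, so an occurrence disappears. All of `J` is kept, which lets the caller choose
    -- any positive `m`.
    Reduction-drop : ∀ {g h m J} → 1 ℕ.≤ m → All (λ j → eval ⟨ y j ⟩ h ≡ true) J →
                     Reduction (g ⊗ h) m J
    Reduction-drop {g} {h} {m} {J} 1≤m hs = record
      { kept    = J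
      ; reduced = g
      ; kept⊆   = ⊆-refl
      ; length≤ = ℕ.m≤n*m (length J) m {{ℕ.>-nonZero 1≤m}}
      ; agree   = λ {j} ρ j∈ ρy → sym (trans
          (cong (eval ρ g ∧_) (eval-mono (⟨⟩≤ᵇ (y j) ρy) h (All.lookup hs j∈)))
          (∧-identityʳ _))
      ; occ-≤   = λ v → ℕ.m≤m+n _ _
      ; occ-<   = λ {j} j∈ →
          ℕ.m<m+n (occ (y j) g) (eval-true⇒occ (y j) h (All.lookup hs j∈))
      }

    Reduction-widen : ∀ {f m m′ J J′} → J′ ⊆ J → (r : Reduction f m J′) →
                      length J ℕ.≤ m′ ℕ.* length (kept r) → Reduction f m′ J
    Reduction-widen J⊆ r len = record
      { kept    = kept r
      ; reduced = reduced r
      ; kept⊆   = ⊆-trans (kept⊆ r) J⊆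
      ; length≤ = len
      ; agree   = agree r
      ; occ-≤   = occ-≤ r
      ; occ-<   = occ-< r
      }

    -- Weighted pigeonhole: only the reduction that keeps more indices is carried out. If it keeps k
    -- of them, the two parts of `J` have at most a * k and b * k elements.
    Reduction-split : ∀ {f a b J} {P Q : I → Set} → All (λ j → P j ⊎ Q j) J →
                      (∀ {J′} → All P J′ → Reduction f a J′) →
                      (∀ {J′} → All Q J′ → Reduction f b J′) →
                      Reduction f (a ℕ.+ b) J
    Reduction-split {a = a} {b} pqs reduceP reduceQ with All-split pqs
    ... | J₁ , J₂ , (J₁⊆ , ps) , (J₂⊆ , qs) , len =
      case ℕ.≤-total k₂ k₁ of λ where
        (inj₁ k₂≤k₁) → Reduction-widen J₁⊆ r₁ (bound ℕ.≤-refl k₂≤k₁)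
        (inj₂ k₁≤k₂) → Reduction-widen J₂⊆ r₂ (bound k₁≤k₂ ℕ.≤-refl)
      where
      r₁ = reduceP ps
      r₂ = reduceQ qs
      k₁ = length (kept r₁)
      k₂ = length (kept r₂)

      bound : ∀ {k} → k₁ ℕ.≤ k → k₂ ℕ.≤ k → _ ℕ.≤ (a ℕ.+ b) ℕ.* k
      bound {k} k₁≤k k₂≤k = begin
        _                         ≡⟨ len ⟩
        length J₁ ℕ.+ length J₂   ≤⟨ ℕ.+-mono-≤ (length≤ r₁) (length≤ r₂) ⟩
        a ℕ.* k₁ ℕ.+ b ℕ.* k₂     ≤⟨ ℕ.+-mono-≤ (ℕ.*-monoʳ-≤ a k₁≤k) (ℕ.*-monoʳ-≤ b k₂≤k) ⟩
        a ℕ.* k ℕ.+ b ℕ.* k       ≡⟨ ℕ.*-distribʳ-+ k a b ⟨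
        (a ℕ.+ b) ℕ.* k           ∎
        where open ℕ.≤-Reasoning

    module _ (x : V) where

      -- For `f` false at `x`, this makes `x` and `y j` a minterm of `f`.
      Joint : Formula V → I → Set
      Joint f j = eval ⟨ y j ⟩ f ≡ false × eval ⟪ x , y j ⟫ f ≡ true

      -- The ratio comes out as `occ x f` because occurrences add up over the two branches of a
      -- gate, just as ratios do in `Reduction-split`.
      reduce : ∀ f J → eval ⟨ x ⟩ f ≡ false → All (Joint f) J → Reduction f (occ x f) J

      reduce-⊗ : ∀ g h J → eval ⟨ x ⟩ g ≡ true → eval ⟨ x ⟩ h ≡ false →
                 All (Joint (g ⊗ h)) J → Reduction (g ⊗ h) (occ x g ℕ.+ occ x h) J
      reduce-⊗ g h J xg xh js = Reduction-split (All.map step js)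
        (Reduction-drop (eval-true⇒occ x g xg))
        (Reduction-⊗ʳ ∘ reduce h _ xh)
        where
        step : ∀ {j} → Joint (g ⊗ h) j → eval ⟨ y j ⟩ h ≡ true ⊎ Joint h j
        step {j} (_ , q) with eval ⟨ y j ⟩ h in eq
        ... | true  = inj₁ refl
        ... | false = inj₂ (refl , proj₂ (∧-true q))

      reduce (var v) [] xf js = record
        { kept = [] ; reduced = var v ; kept⊆ = [] ; length≤ = z≤n
        ; agree = λ _ () ; occ-≤ = λ _ → ℕ.≤-refl ; occ-< = λ () }
      reduce (var v) (j ∷ J) xf ((p , q) ∷ js) =
        contradiction (cong₂ _∨_ xf p) (true≢false q)
      reduce (g ⊕ h) J xf js = Reduction-split (All.map step js)
        (Reduction-⊕ˡ ∘ reduce g _ (proj₁ (∨-false xf)))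
        (Reduction-⊕ʳ ∘ reduce h _ (proj₂ (∨-false {eval ⟨ x ⟩ g} xf)))
        where
        step : ∀ {j} → Joint (g ⊕ h) j → Joint g j ⊎ Joint h j
        step {j} (p , q) with ∨-false {eval ⟨ y j ⟩ g} p | ∨-true {eval ⟪ x , y j ⟫ g} q
        ... | pg , ph | inj₁ qg = inj₁ (pg , qg)
        ... | pg , ph | inj₂ qh = inj₂ (ph , qh)
      reduce (g ⊗ h) J xf js with eval ⟨ x ⟩ g in xg | eval ⟨ x ⟩ h in xh
      ... | true  | false = reduce-⊗ g h J xg xh js
      ... | false | true  = subst (λ m → Reduction (g ⊗ h) m J) (ℕ.+-comm (occ x h) _)
        (Reduction-swap (reduce-⊗ h g J xh xg (All.map swap js)))
        where
        swap : ∀ {j} → Joint (g ⊗ h) j → Joint (h ⊗ g) j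
        swap {j} (p , q) = trans (∧-comm (eval ⟨ y j ⟩ h) _) p ,
                           trans (∧-comm (eval ⟪ x , y j ⟫ h) _) q
      ... | false | false = Reduction-split (All.map step js)
        (Reduction-⊗ˡ ∘ reduce g _ xg)
        (Reduction-⊗ʳ ∘ reduce h _ xh)
        where
        step : ∀ {j} → Joint (g ⊗ h) j → Joint g j ⊎ Joint h j
        -- The gate is false at `y j` alone, so some factor is, while both are true at the pair.
        step {j} (p , q) with eval ⟨ y j ⟩ g
        ... | true  = inj₂ (p , proj₂ (∧-true q))
        ... | false = inj₁ (refl , proj₁ (∧-true q))

  -- Induction on `b`. A reduced formula may differ from the edge formula, so the hypotheses only
  -- prescribe values at `y j` and at pairs `x i`, `y j` with j in `J`. These assignments make `y j`
  -- true, hence `agree` preserves the values for every kept index.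
  length-bound : ∀ {n} (x y : Fin n → V) k b f (J : List (Fin n)) →
                 AllPairs Fin._<_ J →
                 (∀ i → occ (x i) f ℕ.≤ k) →
                 (∀ {j} → j ∈ J → occ (y j) f ℕ.≤ b) →
                 (∀ {j} → j ∈ J → eval ⟨ y j ⟩ f ≡ false) →
                 (∀ i {j} → j ∈ J → i Fin.≤ j → eval ⟪ x i , y j ⟫ f ≡ true) →
                 (∀ i {j} → j ∈ J → j Fin.< i → eval ⟪ x i , y j ⟫ f ≡ false) →
                 length J ℕ.≤ suc k ℕ.^ b
  length-bound x y k b f []      _ _ _ _ _ _ = z≤n
  length-bound x y k b f (_ ∷ []) _ _ _ _ _ _ = ℕ.m^n>0 (suc k) b
  length-bound x y k b f (i₀ ∷ i₁ ∷ J) ((i₀<i₁ ∷ _) ∷ J↗@(i₁<J ∷ _)) occ-x occ-y y-false up down =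
    go b occ-y
    where
    J₁ = i₁ ∷ J

    -- `agree` is silent on assignments that make no kept `y j` true, so falsity at `x i₁` alone
    -- must be recovered in each round: it follows by monotonicity from the non-edge between `x i₁`
    -- and `y i₀`. This is why `i₀` is set aside.
    x-false : eval ⟨ x i₁ ⟩ f ≡ false
    x-false = ¬-not λ eq → true≢false
      (eval-mono (⟨⟩≤ᵇ⟪⟫ (x i₁) (y i₀)) f eq) (down i₁ (here refl) i₀<i₁)

    r : Reduction y f (occ (x i₁) f) J₁
    r = reduce y (x i₁) f J₁ x-false (All.tabulate λ j∈ →
      y-false (there j∈) , up i₁ (there j∈) (All.lookup (Fin.≤-refl ∷ All.map ℕ.<⇒≤ i₁<J) j∈))

    open Reduction r

    kept⊆J : ∀ {j} → j ∈ kept → j ∈ i₀ ∷ J₁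
    kept⊆J = there ∘ lookup kept⊆

    same : ∀ i {j} → j ∈ kept → eval ⟪ x i , y j ⟫ reduced ≡ eval ⟪ x i , y j ⟫ f
    same i {j} j∈ = agree ⟪ x i , y j ⟫ j∈ (⟪⟫-right (x i) (y j))

    go : ∀ b → (∀ {j} → j ∈ i₀ ∷ J₁ → occ (y j) f ℕ.≤ b) → length (i₀ ∷ J₁) ℕ.≤ suc k ℕ.^ b
    -- With no occurrence left to lose nothing can be kept, yet `J₁` contains `i₁`.
    go zero occ-y = contradiction (ℕ.≤-trans length≤ (ℕ.≤-reflexive kept-empty)) λ ()
      where
      kept-empty : occ (x i₁) f ℕ.* length kept ≡ 0
      kept-empty = trans
        (cong (occ (x i₁) f ℕ.*_) (empty-length λ j∈ →
          ℕ.n≮0 (ℕ.<-≤-trans (occ-< j∈) (occ-y (kept⊆J j∈)))))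
        (ℕ.*-zeroʳ (occ (x i₁) f))
    go (suc b) occ-y = begin
      suc (length J₁)                    ≤⟨ s≤s length≤ ⟩
      suc (occ (x i₁) f ℕ.* length kept) ≤⟨ s≤s (ℕ.*-mono-≤ (occ-x i₁) ih) ⟩
      -- The 1 counts `i₀` and is absorbed by one extra copy of the power.
      suc (k ℕ.* suc k ℕ.^ b)            ≤⟨ ℕ.+-monoˡ-≤ _ (ℕ.m^n>0 (suc k) b) ⟩
      suc k ℕ.^ suc b                    ∎
      where
      open ℕ.≤-Reasoning
      ih : length kept ℕ.≤ suc k ℕ.^ b
      ih = length-bound x y k b reduced kept (AllPairs-resp-⊆ kept⊆ J↗)
        (λ i → ℕ.≤-trans (occ-≤ (x i)) (occ-x i))
        (λ j∈ → ℕ.≤-pred (ℕ.<-≤-trans (occ-< j∈) (occ-y (kept⊆J j∈))))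
        (λ {j} j∈ → trans (agree ⟨ y j ⟩ j∈ (⟨⟩-self (y j))) (y-false (kept⊆J j∈)))
        (λ i j∈ i≤j → trans (same i j∈) (up i (kept⊆J j∈) i≤j))
        (λ i j∈ j<i → trans (same i j∈) (down i (kept⊆J j∈) j<i))

-- Truth values of the edge formula.

∑-true⁺ : ∀ {V} {ρ : V → Bool} {f fs} → f ∈ fs → eval ρ f ≡ true → evalSum ρ (∑ fs) ≡ true
∑-true⁺ {fs = _ ∷ []}     (here refl) eq = eq
∑-true⁺ {fs = _ ∷ _ ∷ _}  (here refl) eq rewrite eq = refl
∑-true⁺ {fs = _ ∷ _ ∷ _}  (there f∈)  eq = trans (cong (_ ∨_) (∑-true⁺ f∈ eq)) (∨-zeroʳ _)

∑-true⁻ : ∀ {V} {ρ : V → Bool} fs → evalSum ρ (∑ fs) ≡ true → ∃[ f ] f ∈ fs × eval ρ f ≡ true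
∑-true⁻ (f ∷ [])         eq = f , here refl , eq
∑-true⁻ {ρ = ρ} (f ∷ fs@(_ ∷ _)) eq =
  [ (λ p → f , here refl , p)
  , (λ p → let g , g∈ , q = ∑-true⁻ fs p in g , there g∈ , q)
  ]′ (∨-true {eval ρ f} eq)

module _ (𝒢 : Graph) where
  open Graph 𝒢

  edgesAmong-⊆Adj : ∀ us {u v} → (u , v) ∈ edgesAmong us → Adj u v
  edgesAmong-⊆Adj (w ∷ us) uv∈ with ∈-++⁻ (map (w ,_) _) uv∈
  ... | inj₂ uv∈us = edgesAmong-⊆Adj us uv∈us
  ... | inj₁ uv∈w with ∈-map⁻ (w ,_) uv∈w
  ...   | v , v∈ , refl = proj₂ (∈-filter⁻ (adj? w) {xs = us} v∈)

  -- Edges are listed in vertex order only. In `G n` every x precedes every y, so cutting the vertex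
  -- list between them reaches all edges.
  ∈-edgesAmong-++ : ∀ us {vs u v} → u ∈ us → v ∈ vs → Adj u v → (u , v) ∈ edgesAmong (us ++ vs)
  ∈-edgesAmong-++ (u ∷ us) (here refl) v∈ uv =
    ∈-++⁺ˡ (∈-map⁺ (u ,_) (∈-filter⁺ (adj? u) (∈-++⁺ʳ us v∈) uv))
  ∈-edgesAmong-++ (w ∷ us) (there u∈)  v∈ uv = ∈-++⁺ʳ _ (∈-edgesAmong-++ us u∈ v∈ uv)

  φ-true⁺ : ∀ {ρ u v} → (u , v) ∈ edges → ρ u ≡ true → ρ v ≡ true → evalSum ρ (φ 𝒢) ≡ true
  φ-true⁺ uv∈ ρu ρv = ∑-true⁺ (∈-map⁺ _ uv∈) (cong₂ _∧_ ρu ρv)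

  φ-true⁻ : ∀ {ρ} → evalSum ρ (φ 𝒢) ≡ true → ∃₂ λ u v → Adj u v × ρ u ≡ true × ρ v ≡ true
  φ-true⁻ {ρ} eq with ∑-true⁻ {ρ = ρ} (map term edges) eq
    where
    term : V × V → Formula V
    term (u , v) = var u ⊗ var v
  ... | _ , f∈ , q with ∈-map⁻ _ f∈
  ...   | (u , v) , uv∈ , refl = u , v , edgesAmong-⊆Adj vertices uv∈ , ∧-true q

-- The counting bound for the half graph.

module _ (n : ℕ) where
  open HalfGraph n
  open Reductions (Graph._≟_ (G n))

  φ-single : ∀ v → evalSum ⟨ v ⟩ (φ (G n)) ≡ false
  φ-single v = ¬-not λ eq → case φ-true⁻ (G n) {⟨ v ⟩} eq of λ where
      (u , w , uw , u≡v , w≡v) →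
        Graph.irreflexive (G n) (trans (⟨⟩-true⁻ u v u≡v) (sym (⟨⟩-true⁻ w v w≡v))) uw

  φ-up : ∀ i j → i Fin.≤ j → evalSum ⟪ x i , y j ⟫ (φ (G n)) ≡ true
  φ-up i j i≤j = φ-true⁺ (G n) {⟪ x i , y j ⟫}
    (∈-edgesAmong-++ (G n) (map inj₁ (allFin n))
      (∈-map⁺ inj₁ (∈-allFin i)) (∈-map⁺ inj₂ (∈-allFin j)) (xy i≤j))
    (⟨⟩≤ᵇ⟪⟫ (x i) (y j) (x i) (⟨⟩-self (x i))) (⟪⟫-right (x i) (y j))

  ⟪⟫-true⁻ : ∀ u v w → ⟪ u , v ⟫ w ≡ true → w ≡ u ⊎ w ≡ v
  ⟪⟫-true⁻ u v w eq with ∨-true {⟨ u ⟩ w} eq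
  ... | inj₁ p = inj₁ (⟨⟩-true⁻ w u p)
  ... | inj₂ p = inj₂ (⟨⟩-true⁻ w v p)

  φ-down : ∀ i j → j Fin.< i → evalSum ⟪ x i , y j ⟫ (φ (G n)) ≡ false
  φ-down i j j<i = ¬-not λ eq → case φ-true⁻ (G n) {⟪ x i , y j ⟫} eq of λ where
      (u , v , uv , pu , pv) → ℕ.<⇒≱ j<i
        (edge uv (⟪⟫-true⁻ (x i) (y j) u pu) (⟪⟫-true⁻ (x i) (y j) v pv))
    where
    edge : ∀ {u v} → Edge u v → u ≡ x i ⊎ u ≡ y j → v ≡ x i ⊎ v ≡ y j → i Fin.≤ j
    edge (xy p) (inj₁ refl) (inj₂ refl) = p
    edge (yx p) (inj₂ refl) (inj₁ refl) = p

  -- `k` enters twice: bounding the x it fixes the factor lost per round, bounding the y it fixes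
  -- the number of rounds.
  read⇒n≤ : ∀ k → HasReadFormula (G n) k → n ℕ.≤ suc k ℕ.^ k
  read⇒n≤ k (f , read , f≡φ) = subst (ℕ._≤ suc k ℕ.^ k) (length-tabulate id)
    (length-bound inj₁ inj₂ k k f (allFin n) (AllPairs.tabulate⁺-< id)
      (λ i → read (x i)) (λ {j} _ → read (y j))
      (λ {j} _ → trans (f≡φ _) (φ-single (y j)))
      (λ i {j} _ i≤j → trans (f≡φ _) (φ-up i j i≤j))
      (λ i {j} _ j<i → trans (f≡φ _) (φ-down i j j<i)))

suc≤2^ : ∀ k → suc k ℕ.≤ 2 ℕ.^ k
suc≤2^ zero    = ℕ.≤-refl
suc≤2^ (suc k) = begin
  suc (suc k)                ≤⟨ ℕ.+-mono-≤ (ℕ.m^n>0 2 k) (suc≤2^ k) ⟩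
  2 ℕ.^ k ℕ.+ 2 ℕ.^ k        ≡⟨ cong (2 ℕ.^ k ℕ.+_) (ℕ.+-identityʳ (2 ℕ.^ k)) ⟨
  2 ℕ.^ suc k                ∎
  where open ℕ.≤-Reasoning

-- A crude estimate that suffices, since the logarithm of n is divided by a quantity that is at
-- least 1.
suc^≤2^ : ∀ k → suc k ℕ.^ k ℕ.≤ 2 ℕ.^ (k ℕ.* k)
suc^≤2^ k = ℕ.≤-trans (ℕ.^-monoˡ-≤ k (suc≤2^ k)) (ℕ.≤-reflexive (ℕ.^-*-assoc 2 k k))

-- Rational powers and bounds on the cuts.

ι : ℕ → ℚᵘ
ι n = + n / 1

ι-mono-≤ : ∀ {a b} → a ℕ.≤ b → ι a ≤ ι b
ι-mono-≤ a≤b = *≤* (ℤ.*-monoʳ-≤-nonNeg (+ 1) (+≤+ a≤b))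

ι-mono-< : ∀ {a b} → a ℕ.< b → ι a < ι b
ι-mono-< a<b = *<* (ℤ.*-monoʳ-<-pos (+ 1) (ℤ.+<+ a<b))

ι-* : ∀ a b → ι a * ι b ≡ ι (a ℕ.* b)
ι-* a b = cong (λ z → mkℚᵘ z 0) (sym (ℤ.pos-* a b))

ι-^ : ∀ a m → ι a ^ℚ m ≡ ι (a ℕ.^ m)
ι-^ a zero    = refl
ι-^ a (suc m) = trans (cong (ι a *_) (ι-^ a m)) (ι-* a (a ℕ.^ m))

^ℚ-nonNeg : ∀ a m → .{{NonNegative a}} → NonNegative (a ^ℚ m)
^ℚ-nonNeg a zero = _
^ℚ-nonNeg a (suc m) = ℚ.nonNeg*nonNeg⇒nonNeg a (a ^ℚ m) {{^ℚ-nonNeg a m}}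

^ℚ-monoˡ-≤ : ∀ {a b} m → .{{NonNegative a}} → a ≤ b → a ^ℚ m ≤ b ^ℚ m
^ℚ-monoˡ-≤ zero    a≤b = ℚ.≤-refl
^ℚ-monoˡ-≤ {a} (suc m) {{a≥0}} a≤b =
  ℚ.*-mono-≤-nonNeg {{a≥0}} {{^ℚ-nonNeg a m}} a≤b (^ℚ-monoˡ-≤ m a≤b)

^ℚ-monoˡ-< : ∀ {a b} m → .{{NonNegative a}} → a < b → a ^ℚ suc m < b ^ℚ suc m
^ℚ-monoˡ-< {a} {b} zero a<b = ℚ.*-monoˡ-<-pos 1ℚᵘ a<b
^ℚ-monoˡ-< {a} (suc m) {{a≥0}} a<b =
  ℚ.*-mono-<-nonNeg {{a≥0}} {{^ℚ-nonNeg a (suc m)}} a<b (^ℚ-monoˡ-< m a<b)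

2^-mono-< : ∀ {e z} → z ℤ.< + e → 2^ z < ι (2 ℕ.^ e)
2^-mono-< {e} {+ m}      (ℤ.+<+ m<e) = ι-mono-< (ℕ.^-monoʳ-< 2 (s≤s (s≤s z≤n)) m<e)
2^-mono-< {e} { -[1+ m ]} _ = ℚ.<-≤-trans
  (1/d<1 (2 ℕ.^ suc m) (ℕ.^-monoʳ-< 2 (s≤s (s≤s z≤n)) {0} {suc m} (s≤s z≤n)))
  (ι-mono-≤ (ℕ.m^n>0 2 e))
  where
  instance _ = ℕ.m^n≢0 2 (suc m)
  1/d<1 : ∀ d .{{_ : ℕ.NonZero d}} → 1 ℕ.< d → + 1 / d < 1ℚᵘ
  1/d<1 (suc d) 1<d = *<* (ℤ.+<+ (subst (1 ℕ.<_) (sym (ℕ.+-identityʳ (suc d))) 1<d))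

2^-mono-≤ : ∀ {e z} → + e ℤ.≤ z → ι (2 ℕ.^ e) ≤ 2^ z
2^-mono-≤ (+≤+ e≤m) = ι-mono-≤ (ℕ.^-monoʳ-≤ 2 e≤m)

2^-cancel-≤ : ∀ {e z} → ι (2 ℕ.^ e) ≤ 2^ z → + e ℤ.≤ z
2^-cancel-≤ le = ℤ.≮⇒≥ λ z<e → ℚ.<⇒≱ (2^-mono-< z<e) le

2^-cancel-< : ∀ {e z} → 2^ z < ι (2 ℕ.^ e) → z ℤ.< + e
2^-cancel-< lt = ℤ.≰⇒> λ e≤z → ℚ.<⇒≱ lt (2^-mono-≤ e≤z)

ι2^-^ : ∀ p d → ι (2 ℕ.^ p) ^ℚ d ≡ ι (2 ℕ.^ (p ℕ.* d))
ι2^-^ p d = trans (ι-^ (2 ℕ.^ p) d) (cong ι (ℕ.^-*-assoc 2 p d))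

-- For t = z/d with witness s, 2^(pd) ≤ s^d ≤ 2^z, hence pd ≤ z. Hypothesis and conclusion both
-- speak of upper cuts, so the lemma applies again to an iterated logarithm.
log₂-upper : ∀ {a} p {t} → (∀ {s} → upper a s → ι (2 ℕ.^ p) ≤ s) → upper (log₂ a) t → ι p ≤ t
log₂-upper p {t} 2^p≤a (s , _ , a<s , s^≤) = *≤* (subst₂ ℤ._≤_
  (ℤ.pos-* p (↧ₙ t)) (sym (ℤ.*-identityʳ (↥ t)))
  (2^-cancel-≤ (subst (_≤ 2^ (↥ t)) (ι2^-^ p (↧ₙ t))
    (ℚ.≤-trans (^ℚ-monoˡ-≤ (↧ₙ t) (2^p≤a a<s)) s^≤))))

log₂-lower : ∀ {a} p {t} → (∀ {s} → lower a s → s < ι (2 ℕ.^ p)) → lower (log₂ a) t → t < ι p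
log₂-lower p {t@(mkℚᵘ _ d)} a≤2^p (s , 0<s , s<a , ≤s^) = *<* (subst₂ ℤ._<_
  (sym (ℤ.*-identityʳ (↥ t))) (ℤ.pos-* p (↧ₙ t))
  (2^-cancel-< (ℚ.<-≤-trans
    (ℚ.≤-<-trans ≤s^ (^ℚ-monoˡ-< d {{nonNegative (ℚ.<⇒≤ 0<s)}} (a≤2^p s<a)))
    (ℚ.≤-reflexive (ℚ.≃-reflexive (ι2^-^ p (suc d)))))))

-- In the main case s * s * t lies below the logarithm of n, hence below k * k, while t ≥ 1. Arguing
-- from k ≤ s avoids a separate treatment of the sign of s.
√-quotient-bound : ∀ {n k} → n ≥ 4 → n ℕ.≤ 2 ℕ.^ (k ℕ.* k) →
  ∀ {s} → lower (√ (log₂ (fromℕ n) ÷ᴿ log₂ (log₂ (fromℕ n)))) s → s < ι k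
√-quotient-bound _ _ (inj₁ s<0) = ℚ.<-≤-trans s<0 (ι-mono-≤ z≤n)
√-quotient-bound {n} {k} n≥4 n≤ {s} (inj₂ (t , t-upper , st-lower)) =
  ℚ.≰⇒> λ k≤s → ℚ.<⇒≱ sst<kk (kk≤sst k≤s)
  where
  1≤t : ι 1 ≤ t
  -- From 4 = 2^2 and 2 = 2^1: the inner use gives a logarithm of at least 2, the outer one an
  -- iterated logarithm of at least 1.
  1≤t = log₂-upper {log₂ (fromℕ n)} 1
    (log₂-upper {fromℕ n} 2 (ℚ.≤-trans (ι-mono-≤ n≥4) ∘ ℚ.<⇒≤)) t-upper

  sst<kk : s * s * t < ι (k ℕ.* k)
  sst<kk = log₂-lower {fromℕ n} (k ℕ.* k) (λ r<n → ℚ.<-≤-trans r<n (ι-mono-≤ n≤)) st-lower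

  kk≤sst : ι k ≤ s → ι (k ℕ.* k) ≤ s * s * t
  kk≤sst k≤s = begin
    ι (k ℕ.* k)      ≡⟨ ι-* k k ⟨
    ι k * ι k        ≃⟨ ℚ.*-identityʳ (ι k * ι k) ⟨
    ι k * ι k * ι 1  ≤⟨ ℚ.*-mono-≤-nonNeg {{ℚ.nonNeg*nonNeg⇒nonNeg (ι k) (ι k)}}
                          (ℚ.*-mono-≤-nonNeg k≤s k≤s) 1≤t ⟩
    s * s * t        ∎
    where open ℚ.≤-Reasoning

theorem1p3 : ∃[ c ] ∃[ N ] (0ℚᵘ < c) ×
    (∀ n → n ≥ N → ∀ k → IsReadability (G n) k →
    c · √ (log₂ (fromℕ n) ÷ᴿ log₂ (log₂ (fromℕ n))) ≤ᴿ fromℕ k)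
-- The bound k * k on the logarithm carries no constant factor, so c = 1; and 4 is the least n whose
-- iterated logarithm reaches 1.
theorem1p3 = 1ℚᵘ , 4 , *<* (ℤ.+<+ (s≤s z≤n)) ,
  λ n n≥4 k (read , _) q (s , s-lower , q≤s) → ℚ.≤-<-trans
    (ℚ.≤-trans q≤s (ℚ.≤-reflexive (ℚ.*-identityˡ s)))
    (√-quotient-bound n≥4 (ℕ.≤-trans (read⇒n≤ n k read) (suc^≤2^ k)) s-lower)
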